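{- Let $1<a<b$ be coprime integers and let $D\subseteq G$ be a subdiagram. Then \[ Q(\mathbf{1}_D)=\mathtt{dinv}(D), \] where $\mathbf{1}_D\in\mathbb{R}^G$ is the indicator vector of $D$ (its $i$-th coordinate is $1$ if $i\in D$ and $0$ otherwise). Moreover, if $D\neq\varnothing$ then $Q(\mathbf{1}_D)>0$.
   Context: Fix coprime integers $1<a<b$. Work in the grid $\mathbb{Z}^2$, with $+x$ pointing east and $+y$ pointing north; elements of $\mathbb{Z}^2$ are called cells. Let $g:\mathbb{Z}^2\to\mathbb{Z}$, $g(x,y)=ab-ax-by$ (the value of the cell). For a cell $c=(x,y)$ and an integer $k$, write $c-ka:=(x+k,y)$ (the cell $k$ steps east) and $c-kb:=(x,y+k)$ (the cell $k$ steps north); thus $g(c-ka)=g(c)-ka$ and $g(c-kb)=g(c)-kb$. Let $G=\{(x,y)\in\mathbb{Z}_{\ge1}^2: g(x,y)>0\}$ ($g$ is injective on $G$). A subdiagram is a subset $D\subseteq G$ such that whenever $(x,y)\in D$, $(x',y')\in G$, $x'\le x$ and $y'\le y$, we have $(x',y')\in D$ (equivalently, $D$ is upward closed for the partial order $i\preceq j \iff g(j)-g(i)\in\{ma+nb: m,n\in\mathbb{Z}_{\ge0}\}$). Define $K:\mathbb{Z}\to\mathbb{Z}$ by $K(d)=\mathbf{1}_{d\ge0}-\mathbf{1}_{d\ge a}-\mathbf{1}_{d\ge b}+\mathbf{1}_{d\ge a+b}$ (equivalently $K(d)=\mathbf{1}_{0\le d<a}-\mathbf{1}_{b\le d<a+b}$),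 and the quadratic form on $\mathbb{R}^G$ \[ Q(\mathbf{n})=\sum_{i,j\in G}K\big(g(j)-g(i)\big)\,n_in_j,\qquad \mathbf{n}=(n_i)_{i\in G}. \] For a subdiagram $D$ and $c\in D$, let $\mathrm{arm}_D(c)=\max\{k\ge0: c-ka\in D\}$ and $\mathrm{leg}_D(c)=\max\{k\ge 0: c-kb\in D\}$. Define \[ \mathtt{dinv}(D)=\#\Big\{c\in D:\ \frac{\mathrm{leg}_D(c)}{\mathrm{arm}_D(c)+1}<\frac ab<\frac{\mathrm{leg}_D(c)+1}{\mathrm{arm}_D(c)}\Big\}, \] with the convention that $\frac{\mathrm{leg}_D(c)+1}{0}=+\infty$. -}

module Defs where

open import Data.Bool.Base using (if_then_else_)
open import Data.Empty using (⊥-elim)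
open import Data.Integer.Base as ℤ using (ℤ; +_; +[1+_]; 0ℤ; 1ℤ)
import Data.Integer.Properties as ℤ
open import Data.List.Base using (List; []; _∷_; foldr; length; filter; map; upTo; cartesianProduct)
open import Data.List.Membership.Propositional using (_∈_)
open import Data.List.Membership.Propositional.Properties
  using (∈-filter⁺; ∈-filter⁻; ∈-cartesianProduct⁺; ∈-map⁺; ∈-upTo⁺)
open import Data.List.Relation.Unary.Unique.Propositional using (Unique)
import Data.List.Relation.Unary.Unique.Propositional.Properties as Unique
open import Data.Nat.Base as ℕ using (ℕ; zero; suc; s≤s; z≤n)
import Data.Nat.Properties as ℕ
open import Data.Product.Base using (_×_; _,_; proj₁; proj₂)
open import Data.Rational.Unnormalised.Base as ℚᵘ using (ℚᵘ; _/_)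
import Data.Rational.Unnormalised.Properties as ℚᵘ
open import Data.Sum.Base using (inj₁; inj₂)
open import Data.Unit.Base using (⊤; tt)
open import Function.Base using (_∘_)
open import Level using (Level; 0ℓ)
open import Relation.Binary.PropositionalEquality
  using (_≡_; refl; sym; trans; cong; cong₂; subst)
open import Relation.Nullary.Decidable using (Dec; yes; no; does; _×-dec_)
open import Relation.Unary using (Pred; Decidable; _⊆_)

private variable
  ℓ : Level

Cell : Set
Cell = ℤ × ℤ

g : (a b : ℕ) → Cell → ℤ
g a b (x , y) = + a ℤ.* + b ℤ.- + a ℤ.* x ℤ.- + b ℤ.* y

-- east c k is the cell written c - ka, and north c k the cell written c - kb:
-- the names of the latter refer to the effect of the step on the value g.
east north : Cell → ℕ → Cell
east  (x , y) k = x ℤ.+ + k , y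
north (x , y) k = x , y ℤ.+ + k

G : (a b : ℕ) → Pred Cell 0ℓ
G a b c@(x , y) = 1ℤ ℤ.≤ x × 1ℤ ℤ.≤ y × 0ℤ ℤ.< g a b c

G? : (a b : ℕ) → Decidable (G a b)
G? a b c@(x , y) = (1ℤ ℤ.≤? x) ×-dec ((1ℤ ℤ.≤? y) ×-dec (0ℤ ℤ.<? g a b c))

-- The elements of G, each listed once (see ∈-cellsG⁺, ∈-cellsG⁻ and
-- cellsG-unique): x, y ≥ 1 and g > 0 force x ≤ b and y ≤ a.
cellsG : (a b : ℕ) → List Cell
cellsG a b = filter (G? a b) (cartesianProduct (map +[1+_] (upTo b)) (map +[1+_] (upTo a)))

record IsSubdiagram (a b : ℕ) (D : Pred Cell ℓ) : Set ℓ where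
  field
    D⊆G        : D ⊆ G a b
    downClosed : ∀ {x y x′ y′} → D (x , y) → G a b (x′ , y′) →
                 x′ ℤ.≤ x → y′ ℤ.≤ y → D (x′ , y′)

𝟏 : {P : Set ℓ} → Dec P → ℤ
𝟏 P? = if does P? then 1ℤ else 0ℤ

K : (a b : ℕ) → ℤ → ℤ
K a b d = 𝟏 (0ℤ ℤ.≤? d) ℤ.- 𝟏 (+ a ℤ.≤? d) ℤ.- 𝟏 (+ b ℤ.≤? d) ℤ.+ 𝟏 (+ (a ℕ.+ b) ℤ.≤? d)

∑ : {A : Set} → List A → (A → ℤ) → ℤ
∑ xs f = foldr (λ x s → f x ℤ.+ s) 0ℤ xs

-- A vector indexed by G is given by a function on all cells, of which only the
-- values on G are used.  The coefficients of the form are integers, so on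
-- integer vectors it takes the same value as the form over the reals.
Q : (a b : ℕ) → (Cell → ℤ) → ℤ
Q a b n = ∑ (cellsG a b) λ i → ∑ (cellsG a b) λ j →
  K a b (g a b j ℤ.- g a b i) ℤ.* n i ℤ.* n j

indicator : {D : Pred Cell ℓ} → Decidable D → Cell → ℤ
indicator D? i = 𝟏 (D? i)

-- The largest k with 1 ≤ k ≤ N satisfying P, or 0 if there is none.
largest : {P : Pred ℕ ℓ} → Decidable P → (N : ℕ) → ℕ
largest P? zero    = zero
largest P? (suc N) = if does (P? (suc N)) then suc N else largest P? N

-- A cell of G has 1 ≤ x ≤ b and 1 ≤ y ≤ a, so for D ⊆ G and c ∈ D the bounds b
-- and a lose nothing: see arm-isMax and leg-isMax.
arm leg : (a b : ℕ) {D : Pred Cell ℓ} → Decidable D → Cell → ℕ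
arm a b D? c = largest (λ k → D? (east c k)) b
leg a b D? c = largest (λ k → D? (north c k)) a

-- q < n / m in the extended sense, with n / 0 = +∞.
_<[_/∞_] : ℚᵘ → ℕ → ℕ → Set
q <[ n /∞ zero  ] = ⊤
q <[ n /∞ suc m ] = q ℚᵘ.< + n / suc m

_<[_/∞_]? : ∀ q n m → Dec (q <[ n /∞ m ])
q <[ n /∞ zero  ]? = yes tt
q <[ n /∞ suc m ]? = q ℚᵘ.<? + n / suc m

module _ (a b : ℕ) .{{_ : ℕ.NonZero b}} where

  Balanced : {D : Pred Cell ℓ} → Decidable D → Pred Cell 0ℓ
  Balanced D? c =
    (+ leg a b D? c / suc (arm a b D? c)) ℚᵘ.< (+ a / b) ×
    (+ a / b) <[ suc (leg a b D? c) /∞ arm a b D? c ]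

  balanced? : {D : Pred Cell ℓ} (D? : Decidable D) → Decidable (Balanced D?)
  balanced? D? c =
    ((+ leg a b D? c / suc (arm a b D? c)) ℚᵘ.<? (+ a / b)) ×-dec
    ((+ a / b) <[ suc (leg a b D? c) /∞ arm a b D? c ]?)

  dinv : {D : Pred Cell ℓ} → Decidable D → ℕ
  dinv D? = length (filter (λ c → D? c ×-dec balanced? D? c) (cellsG a b))

private
  sub-pos : ∀ i j → 0ℤ ℤ.< i ℤ.- j → j ℤ.< i
  sub-pos i j p = subst (ℤ._< i) (ℤ.+-identityˡ j) (subst (0ℤ ℤ.+ j ℤ.<_)
    (trans (ℤ.+-assoc i (ℤ.- j) j) (trans (cong (λ t → i ℤ.+ t) (ℤ.+-inverseˡ j)) (ℤ.+-identityʳ i)))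
    (ℤ.+-monoˡ-< j p))

  sub-≤ : ∀ i a m → i ℤ.- + a ℤ.* + m ℤ.≤ i
  sub-≤ i a m = subst (λ t → i ℤ.- t ℤ.≤ i) (ℤ.pos-* a m) (ℤ.i-j≤i i (+ (a ℕ.* m)))

  cancel : ∀ a m b → + a ℤ.* + m ℤ.< + a ℤ.* + b → m ℕ.< b
  cancel a m b p = ℕ.*-cancelˡ-< a m b (ℤ.drop‿+<+
    (subst (ℤ._< + (a ℕ.* b)) (sym (ℤ.pos-* a m))
      (subst (λ t → + a ℤ.* + m ℤ.< t) (sym (ℤ.pos-* a b)) p)))

  G⇒x<b : ∀ a b m n → 0ℤ ℤ.< g a b (+ m , + n) → m ℕ.< b
  G⇒x<b a b m n p = cancel a m b (sub-pos (+ a ℤ.* + b) (+ a ℤ.* + m)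
    (ℤ.<-≤-trans p (sub-≤ (+ a ℤ.* + b ℤ.- + a ℤ.* + m) b n)))

  G⇒y<a : ∀ a b m n → 0ℤ ℤ.< g a b (+ m , + n) → n ℕ.< a
  G⇒y<a a b m n p = cancel b n a
    (subst (λ t → + b ℤ.* + n ℤ.< t) (ℤ.*-comm (+ a) (+ b))
      (ℤ.<-≤-trans (sub-pos (+ a ℤ.* + b ℤ.- + a ℤ.* + m) (+ b ℤ.* + n) p)
        (sub-≤ (+ a ℤ.* + b) a m)))

∈-cellsG⁺ : ∀ {a b c} → G a b c → c ∈ cellsG a b
∈-cellsG⁺ {a} {b} {+[1+ m ] , +[1+ n ]} c∈G@(_ , _ , 0<g) =
  ∈-filter⁺ (G? a b) (∈-cartesianProduct⁺
    (∈-map⁺ +[1+_] (∈-upTo⁺ (ℕ.<-trans (ℕ.n<1+n m) (G⇒x<b a b (suc m) (suc n) 0<g))))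
    (∈-map⁺ +[1+_] (∈-upTo⁺ (ℕ.<-trans (ℕ.n<1+n n) (G⇒y<a a b (suc m) (suc n) 0<g))))) c∈G
∈-cellsG⁺ {c = + zero , _} (ℤ.+≤+ () , _)
∈-cellsG⁺ {c = ℤ.-[1+ _ ] , _} (() , _)
∈-cellsG⁺ {c = +[1+ _ ] , + zero} (_ , ℤ.+≤+ () , _)
∈-cellsG⁺ {c = +[1+ _ ] , ℤ.-[1+ _ ]} (_ , () , _)

∈-cellsG⁻ : ∀ {a b c} → c ∈ cellsG a b → G a b c
∈-cellsG⁻ {a} {b} c∈ = proj₂ (∈-filter⁻ (G? a b) {xs = cartesianProduct (map +[1+_] (upTo b)) (map +[1+_] (upTo a))} c∈)

cellsG-unique : ∀ a b → Unique (cellsG a b)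
cellsG-unique a b = Unique.filter⁺ (G? a b) (Unique.cartesianProduct⁺
  (Unique.map⁺ ℤ.+[1+-injective (Unique.upTo⁺ b))
  (Unique.map⁺ ℤ.+[1+-injective (Unique.upTo⁺ a)))

record IsMax (P : Pred ℕ ℓ) (m : ℕ) : Set ℓ where
  field
    attained : P m
    upper    : ∀ {k} → P k → k ℕ.≤ m

largest-isMax : {P : Pred ℕ ℓ} (P? : Decidable P) (N : ℕ) →
                P 0 → (∀ {k} → P k → k ℕ.≤ N) → IsMax P (largest P? N)
largest-isMax P? zero    p0 bd = record { attained = p0 ; upper = bd }
largest-isMax {P = P} P? (suc N) p0 bd with P? (suc N)
... | yes p = record { attained = p ; upper = bd }
... | no ¬p = largest-isMax P? N p0 bd′
  where
  bd′ : ∀ {k} → P k → k ℕ.≤ N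
  bd′ pk with ℕ.m≤n⇒m<n∨m≡n (bd pk)
  ... | inj₁ (s≤s k≤N) = k≤N
  ... | inj₂ refl      = ⊥-elim (¬p pk)

module _ {a b : ℕ} {D : Pred Cell ℓ} (D? : Decidable D) (D⊆G : D ⊆ G a b) where

  arm-isMax : ∀ {c} → D c → IsMax (λ k → D (east c k)) (arm a b D? c)
  arm-isMax {x , y} d = largest-isMax (λ k → D? (east (x , y) k)) b
    (subst (λ t → D (t , y)) (sym (ℤ.+-identityʳ x)) d) (bd (D⊆G d))
    where
    bd : G a b (x , y) → ∀ {k} → D (east (x , y) k) → k ℕ.≤ b
    bd (ℤ.+≤+ {n = m} _ , ℤ.+≤+ {n = n} _ , _) {k} e =
      ℕ.≤-trans (ℕ.m≤n+m k m) (ℕ.<⇒≤ (G⇒x<b a b (m ℕ.+ k) n (proj₂ (proj₂ (D⊆G e)))))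

  leg-isMax : ∀ {c} → D c → IsMax (λ k → D (north c k)) (leg a b D? c)
  leg-isMax {x , y} d = largest-isMax (λ k → D? (north (x , y) k)) a
    (subst (λ t → D (x , t)) (sym (ℤ.+-identityʳ y)) d) (bd (D⊆G d))
    where
    bd : G a b (x , y) → ∀ {k} → D (north (x , y) k) → k ℕ.≤ a
    bd (ℤ.+≤+ {n = m} _ , ℤ.+≤+ {n = n} _ , _) {k} e =
      ℕ.≤-trans (ℕ.m≤n+m k n) (ℕ.<⇒≤ (G⇒y<a a b m (n ℕ.+ k) (proj₂ (proj₂ (D⊆G e)))))

{-# OPTIONS --safe #-}

-- Write H(d) = 1 for d ≥ 0 and H(d) = 0 otherwise, and M(d) = H(d) - H(d - a), so that
-- K(d) = M(d) - M(d - b).  Group the pairs of cells in Q(1_D) by pairs of columns, and put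
-- the columns (x, x+s) and (x+s, x) together.  For a fixed cell (x+s, z) of D the cell
-- (x, z) is in D too, say with leg L, and summing over column x telescopes to
--   M(bL - as)                      for s = 0,
--   M(bL - as) - M(as - b(L+1))     for s ≥ 1.
-- These values are again differences in s, so for a fixed (x, z), with arm A, the sum over
-- 0 ≤ s ≤ A telescopes to 1 - H(bL - a(A+1)) - H(aA - b(L+1)).  The two inequalities
-- bL ≥ a(A+1) and aA ≥ b(L+1) exclude each other, so this is the indicator of the condition
-- counted by dinv.  A cell with arm and leg 0 always satisfies that condition.
module Submission where

open import Defs
open import Data.Integer.Base as ℤ using (ℤ; +_; +[1+_]; 0ℤ; 1ℤ; _+_; _-_; _*_; -_)
import Data.Integer.Properties as ℤ
open import Data.Integer.Tactic.RingSolver using (solve-∀)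
open import Data.List.Base using (List; []; _∷_; length; filter; map; upTo; cartesianProduct; _++_)
open import Data.List.Properties using (map-upTo)
open import Data.List.Membership.Propositional using (_∈_)
open import Data.List.Membership.Propositional.Properties
  using (∈-filter⁺; ∈-filter⁻; ∈-cartesianProduct⁻; ∈-map⁻; ∈-upTo⁻)
open import Data.Nat.Base as ℕ using (ℕ; zero; suc; NonZero; _<_; s≤s; z≤n)
import Data.Nat.Properties as ℕ
open import Data.Nat.Coprimality using (Coprime)
open import Data.Product.Base using (_×_; _,_; ∃; proj₁; proj₂)
import Data.Rational.Unnormalised.Base as ℚᵘ
import Data.Rational.Unnormalised.Properties as ℚᵘ
open import Data.Sum.Base using (inj₁; inj₂)
open import Data.Product.Function.NonDependent.Propositional using (_×-⇔_)
open import Function.Base using (_∘_)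
open import Function.Bundles using (_⇔_; mk⇔; Equivalence)
open import Level using (Level)
open import Relation.Binary.PropositionalEquality
open import Relation.Nullary.Decidable using (Dec; yes; no; _×-dec_)
open import Relation.Nullary.Negation using (¬_; contradiction)
open import Relation.Unary using (Pred; Decidable; Empty)

private variable
  ℓ ℓ′ : Level
  X Y : Set

-- Finite sums over lists

∑-cong : (xs : List X) {f h : X → ℤ} → (∀ x → f x ≡ h x) → ∑ xs f ≡ ∑ xs h
∑-cong []       eq = refl
∑-cong (x ∷ xs) eq = cong₂ _+_ (eq x) (∑-cong xs eq)

∑-zero : (xs : List X) → ∑ xs (λ _ → 0ℤ) ≡ 0ℤ
∑-zero []       = refl
∑-zero (x ∷ xs) = trans (ℤ.+-identityˡ _) (∑-zero xs)

interchange : ∀ p q r s → (p + q) + (r + s) ≡ (p + r) + (q + s)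
interchange = solve-∀

∑-distrib-+ : (xs : List X) (f h : X → ℤ) → ∑ xs (λ x → f x + h x) ≡ ∑ xs f + ∑ xs h
∑-distrib-+ []       f h = refl
∑-distrib-+ (x ∷ xs) f h = trans (cong (_+_ (f x + h x)) (∑-distrib-+ xs f h))
  (interchange (f x) (h x) (∑ xs f) (∑ xs h))

∑-distribˡ-* : (xs : List X) (k : ℤ) (f : X → ℤ) → ∑ xs (λ x → k * f x) ≡ k * ∑ xs f
∑-distribˡ-* []       k f = sym (ℤ.*-zeroʳ k)
∑-distribˡ-* (x ∷ xs) k f = trans (cong (_+_ (k * f x)) (∑-distribˡ-* xs k f))
  (sym (ℤ.*-distribˡ-+ k (f x) (∑ xs f)))

∑-comm : (xs : List X) (ys : List Y) (f : X → Y → ℤ) →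
         ∑ xs (λ x → ∑ ys (f x)) ≡ ∑ ys (λ y → ∑ xs (λ x → f x y))
∑-comm []       ys f = sym (∑-zero ys)
∑-comm (x ∷ xs) ys f = trans (cong (_+_ (∑ ys (f x))) (∑-comm xs ys f))
  (sym (∑-distrib-+ ys (f x) (λ y → ∑ xs (λ x → f x y))))

∑-map : (h : X → Y) (xs : List X) (f : Y → ℤ) → ∑ (map h xs) f ≡ ∑ xs (f ∘ h)
∑-map h []       f = refl
∑-map h (x ∷ xs) f = cong (_+_ (f (h x))) (∑-map h xs f)

∑-++ : (xs ys : List X) (f : X → ℤ) → ∑ (xs ++ ys) f ≡ ∑ xs f + ∑ ys f
∑-++ []       ys f = sym (ℤ.+-identityˡ _)
∑-++ (x ∷ xs) ys f = trans (cong (_+_ (f x)) (∑-++ xs ys f)) (sym (ℤ.+-assoc (f x) (∑ xs f) (∑ ys f)))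

∑-cartesianProduct : (xs : List X) (ys : List Y) (f : X × Y → ℤ) →
                     ∑ (cartesianProduct xs ys) f ≡ ∑ xs (λ x → ∑ ys (λ y → f (x , y)))
∑-cartesianProduct []       ys f = refl
∑-cartesianProduct (x ∷ xs) ys f = trans (∑-++ (map (x ,_) ys) _ f)
  (cong₂ _+_ (∑-map (x ,_) ys f) (∑-cartesianProduct xs ys f))

∑-filter : {P : Pred X ℓ} (P? : Decidable P) (xs : List X) {f : X → ℤ} →
           (∀ x → ¬ P x → f x ≡ 0ℤ) → ∑ (filter P? xs) f ≡ ∑ xs f
∑-filter P? []       f≡0 = refl
∑-filter P? (x ∷ xs) {f} f≡0 with P? x
... | yes _ = cong (_+_ (f x)) (∑-filter P? xs f≡0)
... | no ¬p = trans (∑-filter P? xs f≡0)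
  (trans (sym (ℤ.+-identityˡ _)) (cong (λ t → t + ∑ xs f) (sym (f≡0 x ¬p))))

length-filter : {P : Pred X ℓ} (P? : Decidable P) (xs : List X) →
                + length (filter P? xs) ≡ ∑ xs (𝟏 ∘ P?)
length-filter P? []       = refl
length-filter P? (x ∷ xs) with P? x
... | yes _ = cong (_+_ 1ℤ) (length-filter P? xs)
... | no  _ = trans (length-filter P? xs) (sym (ℤ.+-identityˡ _))

∑-upTo-suc : ∀ n (f : ℕ → ℤ) → ∑ (upTo (suc n)) f ≡ f 0 + ∑ (upTo n) (f ∘ suc)
∑-upTo-suc n f = cong (_+_ (f 0))
  (trans (cong (λ xs → ∑ xs f) (sym (map-upTo suc n))) (∑-map suc (upTo n) f))

-- Induction peels off row 0 and column 0. An off-diagonal pair is indexed by its smaller index and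
-- the distance `suc s`, so that the two orders of the pair meet in one summand.
∑∑-triangle : ∀ n (P : ℕ → ℕ → ℤ) →
  ∑ (upTo n) (λ x → ∑ (upTo n) (P x)) ≡
  ∑ (upTo n) (λ x → P x x + ∑ (upTo (n ℕ.∸ suc x)) (λ s → P x (x ℕ.+ suc s) + P (x ℕ.+ suc s) x))
∑∑-triangle zero    P = refl
∑∑-triangle (suc n) P = begin
  ∑ (upTo (suc n)) (λ x → ∑ (upTo (suc n)) (P x))
    ≡⟨ ∑-upTo-suc n (λ x → ∑ (upTo (suc n)) (P x)) ⟩
  ∑ (upTo (suc n)) (P 0) + ∑ (upTo n) (λ x → ∑ (upTo (suc n)) (P (suc x)))
    ≡⟨ cong₂ _+_ (∑-upTo-suc n (P 0))
         (trans (∑-cong (upTo n) (λ x → ∑-upTo-suc n (P (suc x))))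
                (∑-distrib-+ (upTo n) (λ x → P (suc x) 0) (λ x → ∑ (upTo n) (P (suc x) ∘ suc)))) ⟩
  (P 0 0 + r) + (c + ∑ (upTo n) (λ x → ∑ (upTo n) (P (suc x) ∘ suc)))
    ≡⟨ cong (λ t → (P 0 0 + r) + (c + t)) (∑∑-triangle n (λ x y → P (suc x) (suc y))) ⟩
  (P 0 0 + r) + (c + t)
    ≡⟨ shuffle (P 0 0) r c t ⟩
  (P 0 0 + (r + c)) + t
    ≡⟨ cong (λ u → (P 0 0 + u) + t) (sym (∑-distrib-+ (upTo n) (P 0 ∘ suc) (λ s → P (suc s) 0))) ⟩
  (P 0 0 + ∑ (upTo n) (λ s → P 0 (suc s) + P (suc s) 0)) + t
    ≡⟨ sym (∑-upTo-suc n (λ x → P x x + ∑ (upTo (n ℕ.∸ x)) (λ s → P x (x ℕ.+ suc s) + P (x ℕ.+ suc s) x))) ⟩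
  ∑ (upTo (suc n)) (λ x → P x x + ∑ (upTo (n ℕ.∸ x)) (λ s → P x (x ℕ.+ suc s) + P (x ℕ.+ suc s) x)) ∎
  where
  open ≡-Reasoning
  r = ∑ (upTo n) (P 0 ∘ suc)
  c = ∑ (upTo n) (λ x → P (suc x) 0)
  t = ∑ (upTo n) λ x → P (suc x) (suc x) + ∑ (upTo (n ℕ.∸ suc x)) λ s →
        P (suc x) (suc (x ℕ.+ suc s)) + P (suc (x ℕ.+ suc s)) (suc x)
  shuffle : ∀ p r c t → (p + r) + (c + t) ≡ (p + (r + c)) + t
  shuffle = solve-∀

-- Indicators and telescoping

𝟏-true : {P : Set ℓ} (P? : Dec P) → P → 𝟏 P? ≡ 1ℤ
𝟏-true (yes _) p = refl
𝟏-true (no ¬p) p = contradiction p ¬p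

𝟏-false : {P : Set ℓ} (P? : Dec P) → ¬ P → 𝟏 P? ≡ 0ℤ
𝟏-false (yes p) ¬p = contradiction p ¬p
𝟏-false (no _)  ¬p = refl

𝟏-cong : {P : Set ℓ} {R : Set ℓ′} (P? : Dec P) (R? : Dec R) → (P → R) → (R → P) → 𝟏 P? ≡ 𝟏 R?
𝟏-cong (yes p) R? to from = sym (𝟏-true R? (to p))
𝟏-cong (no ¬p) R? to from = sym (𝟏-false R? (¬p ∘ from))

𝟏-*-false : {P : Set ℓ} (P? : Dec P) {u : ℤ} → ¬ P → 𝟏 P? * u ≡ 0ℤ
𝟏-*-false P? {u} ¬p = trans (cong (_* u) (𝟏-false P? ¬p)) (ℤ.*-zeroˡ u)

𝟏-*-true : {P : Set ℓ} (P? : Dec P) {u : ℤ} → P → 𝟏 P? * u ≡ u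
𝟏-*-true P? {u} p = trans (cong (_* u) (𝟏-true P? p)) (ℤ.*-identityˡ u)

-- Exclusivity keeps the right-hand side from being `-1`, its value if `R` and `S` both held.
𝟏-neither : {P R S : Set ℓ} (P? : Dec P) (R? : Dec R) (S? : Dec S) →
            (¬ R × ¬ S → P) → (P → ¬ R × ¬ S) → (R → ¬ S) → 𝟏 P? ≡ 1ℤ - 𝟏 R? - 𝟏 S?
𝟏-neither P? (no ¬r) (no ¬s) from to excl = 𝟏-true P? (from (¬r , ¬s))
𝟏-neither P? (yes r) (no _)  from to excl = 𝟏-false P? λ p → proj₁ (to p) r
𝟏-neither P? (no _)  (yes s) from to excl = 𝟏-false P? λ p → proj₂ (to p) s
𝟏-neither P? (yes r) (yes s) from to excl = contradiction s (excl r)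

𝟏-× : {P : Set ℓ} {R : Set ℓ′} (P? : Dec P) (R? : Dec R) → 𝟏 (P? ×-dec R?) ≡ 𝟏 P? * 𝟏 R?
𝟏-× (yes _) R? = sym (ℤ.*-identityˡ (𝟏 R?))
𝟏-× (no _)  R? = refl

-- The two implications say that `P` cuts out the segment `k < μ`, so the indicators only truncate a
-- telescoping sum. The induction shifts `P` and `F` together.
∑-telescope : {P : Pred ℕ ℓ} (P? : Decidable P) (n μ : ℕ) (F : ℕ → ℤ) →
  (∀ {k} → P k → k < μ) → (∀ {k} → k < μ → P k) → μ ℕ.≤ n →
  ∑ (upTo n) (λ k → 𝟏 (P? k) * (F k - F (suc k))) ≡ F 0 - F μ
∑-telescope P? zero zero F to from _ = sym (ℤ.+-inverseʳ (F 0))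
∑-telescope P? (suc n) zero F to from _ = begin
  ∑ (upTo (suc n)) (λ k → 𝟏 (P? k) * (F k - F (suc k)))
    ≡⟨ ∑-upTo-suc n (λ k → 𝟏 (P? k) * (F k - F (suc k))) ⟩
  𝟏 (P? 0) * (F 0 - F 1) + ∑ (upTo n) (λ k → 𝟏 (P? (suc k)) * (F (suc k) - F (suc (suc k))))
    ≡⟨ cong₂ _+_ (𝟏-*-false (P? 0) (λ p → contradiction (to p) λ ()))
         (∑-telescope (P? ∘ suc) n zero (F ∘ suc) (λ p → contradiction (to p) λ ()) (λ ()) z≤n) ⟩
  0ℤ + (F 1 - F 1)
    ≡⟨ trans (ℤ.+-identityˡ _) (trans (ℤ.+-inverseʳ (F 1)) (sym (ℤ.+-inverseʳ (F 0)))) ⟩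
  F 0 - F 0 ∎
  where open ≡-Reasoning
∑-telescope P? (suc n) (suc μ) F to from (s≤s μ≤n) = begin
  ∑ (upTo (suc n)) (λ k → 𝟏 (P? k) * (F k - F (suc k)))
    ≡⟨ ∑-upTo-suc n (λ k → 𝟏 (P? k) * (F k - F (suc k))) ⟩
  𝟏 (P? 0) * (F 0 - F 1) + ∑ (upTo n) (λ k → 𝟏 (P? (suc k)) * (F (suc k) - F (suc (suc k))))
    ≡⟨ cong₂ _+_ (𝟏-*-true (P? 0) (from (s≤s z≤n)))
         (∑-telescope (P? ∘ suc) n μ (F ∘ suc) (ℕ.≤-pred ∘ to) (from ∘ s≤s) μ≤n) ⟩
  (F 0 - F 1) + (F 1 - F (suc μ))
    ≡⟨ collapse (F 0) (F 1) (F (suc μ)) ⟩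
  F 0 - F (suc μ) ∎
  where
  open ≡-Reasoning
  collapse : ∀ p q r → (p - q) + (q - r) ≡ p - r
  collapse = solve-∀

-- The step function and the kernel `K`

H : ℤ → ℤ
H d = 𝟏 (0ℤ ℤ.≤? d)

H-nonneg : ∀ {d} → 0ℤ ℤ.≤ d → H d ≡ 1ℤ
H-nonneg {d} = 𝟏-true (0ℤ ℤ.≤? d)

H-neg : ∀ {d} → d ℤ.< 0ℤ → H d ≡ 0ℤ
H-neg {d} = 𝟏-false (0ℤ ℤ.≤? d) ∘ ℤ.<⇒≱

H-shift : ∀ k d → 𝟏 (k ℤ.≤? d) ≡ H (d - k)
H-shift k d = 𝟏-cong (k ℤ.≤? d) (0ℤ ℤ.≤? (d - k)) ℤ.i≤j⇒0≤j-i ℤ.0≤i-j⇒j≤i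

-- The indicator of `0 ≤ d < a`. `M-neg` and `M-large` each kill one end of a telescoped column sum.
M : ℕ → ℤ → ℤ
M a d = H d - H (d - + a)

M-neg : ∀ a {d} → d ℤ.< 0ℤ → M a d ≡ 0ℤ
M-neg a {d} d<0 = cong₂ _-_ (H-neg d<0) (H-neg (ℤ.≤-<-trans (ℤ.i-j≤i d (+ a)) d<0))

M-large : ∀ a {d} → + a ℤ.≤ d → M a d ≡ 0ℤ
M-large a a≤d = cong₂ _-_ (H-nonneg (ℤ.≤-trans (ℤ.+≤+ z≤n) a≤d)) (H-nonneg (ℤ.i≤j⇒0≤j-i a≤d))

K≡M-M : ∀ a b d → K a b d ≡ M a d - M a (d - + b)
K≡M-M a b d = begin
  K a b d
    ≡⟨ cong₂ _+_ (cong₂ _-_ (cong (_-_ (H d)) (H-shift (+ a) d)) (H-shift (+ b) d))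
         (trans (H-shift (+ (a ℕ.+ b)) d) (cong H (swap d (+ a) (+ b)))) ⟩
  H d - H (d - + a) - H (d - + b) + H (d - + b - + a)
    ≡⟨ regroup (H d) (H (d - + a)) (H (d - + b)) (H (d - + b - + a)) ⟩
  M a d - M a (d - + b) ∎
  where
  open ≡-Reasoning
  swap : ∀ d a b → d - (a + b) ≡ d - b - a
  swap = solve-∀
  regroup : ∀ p q r s → p - q - r + s ≡ (p - q) - (r - s)
  regroup = solve-∀

-- The grid in natural-number coordinates

-- Coordinates start from zero, to match `upTo` in `cellsG`. Addition reduces on them, so
-- `east (cell x y) k` is `cell (x + k) y` by computation, and likewise for `north`.
cell : ℕ → ℕ → Cell
cell x y = +[1+ x ] , +[1+ y ]

∑-cellsG : ∀ a b {f : Cell → ℤ} → (∀ c → ¬ G a b c → f c ≡ 0ℤ) →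
           ∑ (cellsG a b) f ≡ ∑ (upTo b) (λ x → ∑ (upTo a) (λ y → f (cell x y)))
∑-cellsG a b {f} f≡0 = begin
  ∑ (cellsG a b) f
    ≡⟨ ∑-filter (G? a b) (cartesianProduct xs ys) f≡0 ⟩
  ∑ (cartesianProduct xs ys) f
    ≡⟨ ∑-cartesianProduct xs ys f ⟩
  ∑ xs (λ x → ∑ ys (λ y → f (x , y)))
    ≡⟨ ∑-map +[1+_] (upTo b) (λ x → ∑ ys (λ y → f (x , y))) ⟩
  ∑ (upTo b) (λ x → ∑ ys (λ y → f (+[1+ x ] , y)))
    ≡⟨ ∑-cong (upTo b) (λ x → ∑-map +[1+_] (upTo a) (λ y → f (+[1+ x ] , y))) ⟩
  ∑ (upTo b) (λ x → ∑ (upTo a) (λ y → f (cell x y))) ∎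
  where
  open ≡-Reasoning
  xs = map +[1+_] (upTo b)
  ys = map +[1+_] (upTo a)

-- The bounds are those of the rectangle behind `cellsG`, read back from the completeness of that
-- list.
cell∈G⇒< : ∀ {a b x y} → G a b (cell x y) → x < b × y < a
cell∈G⇒< {a} {b} c∈G
  with x∈ , y∈ ← ∈-cartesianProduct⁻ (map +[1+_] (upTo b)) (map +[1+_] (upTo a))
                   (proj₁ (∈-filter⁻ (G? a b) {xs = cartesianProduct (map +[1+_] (upTo b)) (map +[1+_] (upTo a))} (∈-cellsG⁺ {a} {b} c∈G)))
  with _ , x∈ , refl ← ∈-map⁻ +[1+_] x∈
  with _ , y∈ , refl ← ∈-map⁻ +[1+_] y∈ = ∈-upTo⁻ x∈ , ∈-upTo⁻ y∈

g-antitone : ∀ a b {x y x′ y′} → x′ ℤ.≤ x → y′ ℤ.≤ y → g a b (x , y) ℤ.≤ g a b (x′ , y′)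
g-antitone a b x′≤x y′≤y = ℤ.+-mono-≤
  (ℤ.+-monoʳ-≤ (+ a * + b) (ℤ.neg-mono-≤ (ℤ.*-monoˡ-≤-nonNeg (+ a) x′≤x)))
  (ℤ.neg-mono-≤ (ℤ.*-monoˡ-≤-nonNeg (+ b) y′≤y))

-- From integers and fractions to inequalities of naturals

pos-linear : ∀ a s b z → + (a ℕ.* s ℕ.+ b ℕ.* z) ≡ + a * + s + + b * + z
pos-linear a s b z = cong₂ _+_ (ℤ.pos-* a s) (ℤ.pos-* b z)

H-⊖ : ∀ a m b n → H (+ a * + m - + b * + n) ≡ 𝟏 (b ℕ.* n ℕ.≤? a ℕ.* m)
H-⊖ a m b n = begin
  H (+ a * + m - + b * + n)             ≡⟨ sym (H-shift (+ b * + n) (+ a * + m)) ⟩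
  𝟏 (+ b * + n ℤ.≤? + a * + m)          ≡⟨ cong₂ (λ u v → 𝟏 (u ℤ.≤? v)) (sym (ℤ.pos-* b n)) (sym (ℤ.pos-* a m)) ⟩
  𝟏 (+ (b ℕ.* n) ℤ.≤? + (a ℕ.* m))      ≡⟨ 𝟏-cong (+ (b ℕ.* n) ℤ.≤? + (a ℕ.* m)) (b ℕ.* n ℕ.≤? a ℕ.* m) ℤ.drop‿+≤+ ℤ.+≤+ ⟩
  𝟏 (b ℕ.* n ℕ.≤? a ℕ.* m) ∎
  where open ≡-Reasoning

/<⇔ : ∀ m n a b .{{_ : NonZero b}} → (+ m ℚᵘ./ suc n) ℚᵘ.< (+ a ℚᵘ./ b) ⇔ b ℕ.* m < a ℕ.* suc n
/<⇔ m n a (suc b) = mk⇔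
  (λ p → ℤ.drop‿+<+ (subst₂ ℤ._<_ lhs rhs (ℚᵘ.drop-*<* p)))
  (λ p → ℚᵘ.*<* (subst₂ ℤ._<_ (sym lhs) (sym rhs) (ℤ.+<+ p)))
  where
  lhs : + m * + suc b ≡ + (suc b ℕ.* m)
  lhs = trans (ℤ.*-comm (+ m) (+ suc b)) (sym (ℤ.pos-* (suc b) m))
  rhs : + a * + suc n ≡ + (a ℕ.* suc n)
  rhs = sym (ℤ.pos-* a (suc n))

<[/∞]⇔ : ∀ n m a b .{{_ : NonZero b}} → ((+ a ℚᵘ./ b) <[ suc n /∞ m ]) ⇔ a ℕ.* m < b ℕ.* suc n
-- With denominator 0 the left side is `⊤` by the convention for infinity, and the right side
-- `a * 0 < b * suc n` holds because `b` is positive.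
<[/∞]⇔ n zero    a (suc b) = mk⇔ (λ _ → subst (_< suc b ℕ.* suc n) (sym (ℕ.*-zeroʳ a)) (s≤s z≤n)) _
<[/∞]⇔ n (suc m) a (suc b) = mk⇔
  (λ p → ℤ.drop‿+<+ (subst₂ ℤ._<_ lhs rhs (ℚᵘ.drop-*<* p)))
  (λ p → ℚᵘ.*<* (subst₂ ℤ._<_ (sym lhs) (sym rhs) (ℤ.+<+ p)))
  where
  lhs : + a * + suc m ≡ + (a ℕ.* suc m)
  lhs = sym (ℤ.pos-* a (suc m))
  rhs : + suc n * + suc b ≡ + (suc b ℕ.* suc n)
  rhs = trans (ℤ.*-comm (+ suc n) (+ suc b)) (sym (ℤ.pos-* (suc b) (suc n)))

balanced⇔ : ∀ a b .{{_ : NonZero b}} {D : Pred Cell ℓ} (D? : Decidable D) c →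
  let A = arm a b D? c ; L = leg a b D? c in
  Balanced a b D? c ⇔ (b ℕ.* L < a ℕ.* suc A × a ℕ.* A < b ℕ.* suc L)
balanced⇔ a b D? c = /<⇔ (leg a b D? c) (arm a b D? c) a b ×-⇔ <[/∞]⇔ (leg a b D? c) (arm a b D? c) a b

-- Columns and rows of a subdiagram

module _ (a b : ℕ) .{{_ : NonZero b}} (0<a : 0 < a)
         {D : Pred Cell ℓ} (D? : Decidable D) (D-sub : IsSubdiagram a b D) where

  open IsSubdiagram D-sub
  open IsMax

  -- `g` can only grow when coordinates shrink, so its positivity is inherited; only positivity of
  -- the new coordinates has to be supplied.
  D-down : ∀ {x y x′ y′} → D (x , y) → 1ℤ ℤ.≤ x′ → 1ℤ ℤ.≤ y′ → x′ ℤ.≤ x → y′ ℤ.≤ y → D (x′ , y′)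
  D-down d 1≤x′ 1≤y′ x′≤x y′≤y = downClosed d
    (1≤x′ , 1≤y′ , ℤ.<-≤-trans (proj₂ (proj₂ (D⊆G d))) (g-antitone a b x′≤x y′≤y)) x′≤x y′≤y

  D-cell-down : ∀ {x y x′ y′} → D (cell x y) → x′ ℕ.≤ x → y′ ℕ.≤ y → D (cell x′ y′)
  D-cell-down d x′≤x y′≤y = D-down d (ℤ.+≤+ (s≤s z≤n)) (ℤ.+≤+ (s≤s z≤n))
    (ℤ.+≤+ (s≤s x′≤x)) (ℤ.+≤+ (s≤s y′≤y))

  armᴰ legᴰ : ℕ → ℕ → ℕ
  armᴰ x y = arm a b D? (cell x y)
  legᴰ x y = leg a b D? (cell x y)

  𝟏ᴰ : ℕ → ℕ → ℤ
  𝟏ᴰ x y = 𝟏 (D? (cell x y))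

  -- A column of `D` is an initial segment, and any of its cells locates the top: its length is
  -- `suc (z + L)`, whichever `z` is chosen.
  ∑-column : ∀ {x z} → D (cell x z) → (F : ℕ → ℤ) →
    ∑ (upTo a) (λ y → 𝟏ᴰ x y * (F y - F (suc y))) ≡ F 0 - F (suc (z ℕ.+ legᴰ x z))
  ∑-column {x} {z} d F = ∑-telescope (λ y → D? (cell x y)) a (suc (z ℕ.+ L)) F
    to (λ y<μ → D-cell-down top ℕ.≤-refl (ℕ.≤-pred y<μ)) (proj₂ (cell∈G⇒< {a} {b} (D⊆G top)))
    where
    L = legᴰ x z
    isMax : IsMax (λ k → D (north (cell x z) k)) L
    isMax = leg-isMax {a = a} {b = b} D? D⊆G d
    top : D (cell x (z ℕ.+ L))
    top = attained isMax
    to : ∀ {y} → D (cell x y) → y < suc (z ℕ.+ L)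
    to {y} e with ℕ.≤-total z y
    ... | inj₂ y≤z = s≤s (ℕ.≤-trans y≤z (ℕ.m≤m+n z L))
    ... | inj₁ z≤y with k , refl ← ℕ.m≤n⇒∃[o]m+o≡n z≤y = s≤s (ℕ.+-monoʳ-≤ z (upper isMax e))

  -- Index `s` stands for the cell `suc s` steps east. The cell `(x, z)` itself is left out, so the
  -- segment has length `armᴰ x z`, without a successor.
  ∑-row : ∀ {x z} → D (cell x z) → (F : ℕ → ℤ) →
    ∑ (upTo (b ℕ.∸ suc x)) (λ s → 𝟏ᴰ (x ℕ.+ suc s) z * (F s - F (suc s))) ≡ F 0 - F (armᴰ x z)
  ∑-row {x} {z} d F = ∑-telescope (λ s → D? (cell (x ℕ.+ suc s) z)) (b ℕ.∸ suc x) A F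
    (upper isMax) (λ s<A → D-cell-down end (ℕ.+-monoʳ-≤ x s<A) ℕ.≤-refl)
    -- The end cell satisfies `x + A < b`, which bounds `A` by the number of columns east of `x`.
    (ℕ.m+n≤o⇒m≤o∸n A (subst (ℕ._≤ b) (trans (cong suc (ℕ.+-comm x A)) (sym (ℕ.+-suc A x)))
      (proj₁ (cell∈G⇒< {a} {b} (D⊆G end)))))
    where
    A = armᴰ x z
    isMax : IsMax (λ k → D (east (cell x z) k)) A
    isMax = arm-isMax {a = a} {b = b} D? D⊆G d
    end : D (cell (x ℕ.+ A) z)
    end = attained isMax

  -- Raising `y` by one lowers `g` at the summed cell by `b`, so the argument of `K` grows by `b`
  -- and `K≡M-M` telescopes. Only the top row survives: one row below the bottom the argument is
  -- negative.
  ∑-column-east : ∀ {x z} s → D (cell x z) →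
    ∑ (upTo a) (λ y → 𝟏ᴰ x y * K a b (g a b (cell (x ℕ.+ s) z) - g a b (cell x y))) ≡
    M a (+ b * + legᴰ x z - + a * + s)
  ∑-column-east {x} {z} s d = begin
    ∑ (upTo a) (λ y → 𝟏ᴰ x y * K a b (g a b (cell (x ℕ.+ s) z) - g a b (cell x y)))
      ≡⟨ ∑-cong (upTo a) (λ y → cong (𝟏ᴰ x y *_) (step y)) ⟩
    ∑ (upTo a) (λ y → 𝟏ᴰ x y * (F y - F (suc y)))
      ≡⟨ ∑-column d F ⟩
    F 0 - F (suc (z ℕ.+ L))
      ≡⟨ cong₂ (λ u v → - u - - v) (M-neg a below)
           (cong (M a) (at-top (+ a) (+ b) (+ s) (+ z) (+ L))) ⟩
    - 0ℤ - - M a (+ b * + L - + a * + s)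
      ≡⟨ trans (ℤ.+-identityˡ _) (ℤ.neg-involutive _) ⟩
    M a (+ b * + L - + a * + s) ∎
    where
    open ≡-Reasoning
    L = legᴰ x z
    -- `F y` is minus `M` at row `y - 1`; the sign and the shift bring the differences into the form
    -- `F y - F (suc y)`.
    F : ℕ → ℤ
    F y = - M a (+ b * (+ y - 1ℤ - + z) - + a * + s)
    difference : ∀ a b x s z y →
      (a * b - a * (1ℤ + (x + s)) - b * (1ℤ + z)) - (a * b - a * (1ℤ + x) - b * (1ℤ + y)) ≡
      b * (1ℤ + y - 1ℤ - z) - a * s
    difference = solve-∀
    previous : ∀ a b s z y → b * (1ℤ + y - 1ℤ - z) - a * s - b ≡ b * (y - 1ℤ - z) - a * s
    previous = solve-∀
    flip : ∀ u v → u - v ≡ - v - - u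
    flip = solve-∀
    step : ∀ y → K a b (g a b (cell (x ℕ.+ s) z) - g a b (cell x y)) ≡ F y - F (suc y)
    step y = begin
      K a b (g a b (cell (x ℕ.+ s) z) - g a b (cell x y))
        ≡⟨ cong (K a b) (difference (+ a) (+ b) (+ x) (+ s) (+ z) (+ y)) ⟩
      K a b e
        ≡⟨ K≡M-M a b e ⟩
      M a e - M a (e - + b)
        ≡⟨ cong (λ t → M a e - M a t) (previous (+ a) (+ b) (+ s) (+ z) (+ y)) ⟩
      M a e - M a (+ b * (+ y - 1ℤ - + z) - + a * + s)
        ≡⟨ flip (M a e) (M a (+ b * (+ y - 1ℤ - + z) - + a * + s)) ⟩
      F y - F (suc y) ∎
      where e = + b * (1ℤ + + y - 1ℤ - + z) - + a * + s
    at-top : ∀ a b s z L → b * (1ℤ + (z + L) - 1ℤ - z) - a * s ≡ b * L - a * s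
    at-top = solve-∀
    negate : ∀ a b s z → - (a * s + b * (1ℤ + z)) ≡ b * (0ℤ - 1ℤ - z) - a * s
    negate = solve-∀
    below : + b * (0ℤ - 1ℤ - + z) - + a * + s ℤ.< 0ℤ
    below = subst (ℤ._< 0ℤ)
      (trans (cong -_ (pos-linear a s b (suc z))) (negate (+ a) (+ b) (+ s) (+ z)))
      (ℤ.neg-mono-< (ℤ.+<+ (ℕ.<-≤-trans (ℕ.>-nonZero⁻¹ b)
        (ℕ.≤-trans (ℕ.m≤m*n b (suc z)) (ℕ.m≤n+m (b ℕ.* suc z) (a ℕ.* s))))))

  -- Here the argument falls by `b` with each step north, so the values at row 0 and just above the
  -- top remain. At row 0 the argument is at least `a`, where `M` vanishes; this relies on a
  -- distance of at least one, hence `suc s`.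
  ∑-column-west : ∀ {x z} s → D (cell x z) →
    ∑ (upTo a) (λ y → 𝟏ᴰ x y * K a b (g a b (cell x y) - g a b (cell (x ℕ.+ suc s) z))) ≡
    - M a (+ a * + suc s - + b * + suc (legᴰ x z))
  ∑-column-west {x} {z} s d = begin
    ∑ (upTo a) (λ y → 𝟏ᴰ x y * K a b (g a b (cell x y) - g a b (cell (x ℕ.+ suc s) z)))
      ≡⟨ ∑-cong (upTo a) (λ y → cong (𝟏ᴰ x y *_) (step y)) ⟩
    ∑ (upTo a) (λ y → 𝟏ᴰ x y * (F y - F (suc y)))
      ≡⟨ ∑-column d F ⟩
    F 0 - F (suc (z ℕ.+ L))
      ≡⟨ cong₂ _-_ (M-large a above) (cong (M a) (at-top (+ a) (+ b) (+ suc s) (+ z) (+ L))) ⟩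
    0ℤ - M a (+ a * + suc s - + b * + suc L)
      ≡⟨ ℤ.+-identityˡ _ ⟩
    - M a (+ a * + suc s - + b * + suc L) ∎
    where
    open ≡-Reasoning
    L = legᴰ x z
    F : ℕ → ℤ
    F y = M a (+ a * + suc s + + b * (+ z - + y))
    difference : ∀ a b x s z y →
      (a * b - a * (1ℤ + x) - b * (1ℤ + y)) - (a * b - a * (1ℤ + (x + s)) - b * (1ℤ + z)) ≡
      a * s + b * (z - y)
    difference = solve-∀
    next : ∀ a b s z y → a * s + b * (z - y) - b ≡ a * s + b * (z - (1ℤ + y))
    next = solve-∀
    step : ∀ y → K a b (g a b (cell x y) - g a b (cell (x ℕ.+ suc s) z)) ≡ F y - F (suc y)
    step y = begin
      K a b (g a b (cell x y) - g a b (cell (x ℕ.+ suc s) z))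
        ≡⟨ cong (K a b) (difference (+ a) (+ b) (+ x) (+ suc s) (+ z) (+ y)) ⟩
      K a b e
        ≡⟨ K≡M-M a b e ⟩
      M a e - M a (e - + b)
        ≡⟨ cong (λ t → M a e - M a t) (next (+ a) (+ b) (+ suc s) (+ z) (+ y)) ⟩
      F y - F (suc y) ∎
      where e = + a * + suc s + + b * (+ z - + y)
    at-top : ∀ a b s z L → a * s + b * (z - (1ℤ + (z + L))) ≡ a * s - b * (1ℤ + L)
    at-top = solve-∀
    above : + a ℤ.≤ + a * + suc s + + b * (+ z - 0ℤ)
    above = subst (+ a ℤ.≤_)
      (trans (pos-linear a (suc s) b z)
        (cong (λ t → + a * + suc s + + b * t) (sym (ℤ.+-identityʳ (+ z)))))
      (ℤ.+≤+ (ℕ.≤-trans (ℕ.m≤m*n a (suc s)) (ℕ.m≤m+n (a ℕ.* suc s) (b ℕ.* z))))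

  -- The contribution of one cell

  𝟏-balanced : ∀ x z → let A = armᴰ x z ; L = legᴰ x z in
    𝟏 (balanced? a b D? (cell x z)) ≡
    1ℤ - H (+ b * + L - + a * + suc A) - H (+ a * + A - + b * + suc L)
  𝟏-balanced x z = begin
    𝟏 (balanced? a b D? (cell x z))
      ≡⟨ 𝟏-neither (balanced? a b D? (cell x z)) (a ℕ.* suc A ℕ.≤? b ℕ.* L) (b ℕ.* suc L ℕ.≤? a ℕ.* A)
           (λ (p , q) → from (balanced⇔ a b D? (cell x z)) (ℕ.≰⇒> p , ℕ.≰⇒> q))
           (λ e → let p , q = to (balanced⇔ a b D? (cell x z)) e in ℕ.<⇒≱ p , ℕ.<⇒≱ q)
           exclusive ⟩
    1ℤ - 𝟏 (a ℕ.* suc A ℕ.≤? b ℕ.* L) - 𝟏 (b ℕ.* suc L ℕ.≤? a ℕ.* A)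
      ≡⟨ cong₂ (λ p q → 1ℤ - p - q) (sym (H-⊖ b L a (suc A))) (sym (H-⊖ a A b (suc L))) ⟩
    1ℤ - H (+ b * + L - + a * + suc A) - H (+ a * + A - + b * + suc L) ∎
    where
    open Equivalence
    open ≡-Reasoning
    A = armᴰ x z
    L = legᴰ x z
    -- Together the two would give `a(A+1) ≤ bL ≤ b(L+1) ≤ aA`, impossible for positive `a`.
    exclusive : a ℕ.* suc A ℕ.≤ b ℕ.* L → ¬ (b ℕ.* suc L ℕ.≤ a ℕ.* A)
    exclusive p q = ℕ.<-irrefl refl (ℕ.<-≤-trans (ℕ.*-monoʳ-< a {{ℕ.>-nonZero 0<a}} (ℕ.n<1+n A))
      (ℕ.≤-trans p (ℕ.≤-trans (ℕ.*-monoʳ-≤ b (ℕ.n≤1+n L)) q)))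

  -- The left side collects the pairs of a cell of column `x` with a cell of row `z` at or east of
  -- that column: in one order for `(x, z)` itself, in both orders further east. The column sums are
  -- differences in `s`, so the row telescopes as well.
  cell-contribution : ∀ x z →
    𝟏ᴰ x z * ∑ (upTo a) (λ y → 𝟏ᴰ x y * K a b (g a b (cell x z) - g a b (cell x y))) +
    ∑ (upTo (b ℕ.∸ suc x)) (λ s → 𝟏ᴰ (x ℕ.+ suc s) z *
      (∑ (upTo a) (λ y → 𝟏ᴰ x y * K a b (g a b (cell (x ℕ.+ suc s) z) - g a b (cell x y))) +
       ∑ (upTo a) (λ y → 𝟏ᴰ x y * K a b (g a b (cell x y) - g a b (cell (x ℕ.+ suc s) z))))) ≡
    𝟏ᴰ x z * 𝟏 (balanced? a b D? (cell x z))
  cell-contribution x z with D? (cell x z)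
  -- If `(x, z)` is outside `D`, so is the rest of row `z` to the east, and every summand vanishes.
  ... | no ¬d = trans (ℤ.+-identityˡ _) (trans
          (∑-cong (upTo (b ℕ.∸ suc x)) (λ s → 𝟏-*-false (D? (cell (x ℕ.+ suc s) z))
            (λ e → ¬d (D-cell-down e (ℕ.m≤m+n x (suc s)) ℕ.≤-refl))))
          (∑-zero (upTo (b ℕ.∸ suc x))))
  ... | yes d = begin
    1ℤ * ∑ (upTo a) (λ y → 𝟏ᴰ x y * K a b (g a b (cell x z) - g a b (cell x y))) +
    ∑ (upTo (b ℕ.∸ suc x)) (λ s → 𝟏ᴰ (x ℕ.+ suc s) z *
      (∑ (upTo a) (λ y → 𝟏ᴰ x y * K a b (g a b (cell (x ℕ.+ suc s) z) - g a b (cell x y))) +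
       ∑ (upTo a) (λ y → 𝟏ᴰ x y * K a b (g a b (cell x y) - g a b (cell (x ℕ.+ suc s) z)))))
      ≡⟨ cong₂ _+_ (trans (ℤ.*-identityˡ _) diagonal)
           (∑-cong (upTo (b ℕ.∸ suc x)) (λ s → cong (𝟏ᴰ (x ℕ.+ suc s) z *_) (off-diagonal s))) ⟩
    (1ℤ - H (+ b * + L - + a)) + ∑ (upTo (b ℕ.∸ suc x)) (λ s → 𝟏ᴰ (x ℕ.+ suc s) z * (F s - F (suc s)))
      ≡⟨ cong (_+_ (1ℤ - H (+ b * + L - + a))) (∑-row d F) ⟩
    (1ℤ - H (+ b * + L - + a)) + (F 0 - F A)
      ≡⟨ cong (λ t → (1ℤ - H (+ b * + L - + a)) + (t - F A)) F0 ⟩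
    (1ℤ - H (+ b * + L - + a)) + (H (+ b * + L - + a) - F A)
      ≡⟨ collapse (H (+ b * + L - + a)) (H (+ b * + L - + a * + suc A)) (H (+ a * + A - + b * + suc L)) ⟩
    1ℤ - H (+ b * + L - + a * + suc A) - H (+ a * + A - + b * + suc L)
      ≡⟨ sym (𝟏-balanced x z) ⟩
    𝟏 (balanced? a b D? (cell x z))
      ≡⟨ sym (ℤ.*-identityˡ _) ⟩
    1ℤ * 𝟏 (balanced? a b D? (cell x z)) ∎
    where
    open ≡-Reasoning
    A = armᴰ x z
    L = legᴰ x z
    -- The east and west sums at distance `suc s` give four `H` terms, and the two negative ones are
    -- the positive ones with `s` raised by one. `F s` consists of the positive ones.
    F : ℕ → ℤ
    F s = H (+ b * + L - + a * + suc s) + H (+ a * + s - + b * + suc L)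
    collapse : ∀ h p q → (1ℤ - h) + (h - (p + q)) ≡ 1ℤ - p - q
    collapse = solve-∀
    -- The second summand of `F 0` has the negative argument `- b * suc L`; what is left cancels
    -- against the diagonal term.
    F0 : F 0 ≡ H (+ b * + L - + a)
    F0 = trans (cong₂ _+_ (cong (λ t → H (+ b * + L - t)) (ℤ.*-identityʳ (+ a))) zero-term) (ℤ.+-identityʳ _)
      where
      zero-term : H (+ a * 0ℤ - + b * + suc L) ≡ 0ℤ
      zero-term = trans (H-⊖ a 0 b (suc L)) (𝟏-false (b ℕ.* suc L ℕ.≤? a ℕ.* 0)
        (ℕ.<⇒≱ (subst (_< b ℕ.* suc L) (sym (ℕ.*-zeroʳ a))
          (ℕ.<-≤-trans (ℕ.>-nonZero⁻¹ b) (ℕ.m≤m*n b (suc L))))))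
    diagonal : ∑ (upTo a) (λ y → 𝟏ᴰ x y * K a b (g a b (cell x z) - g a b (cell x y))) ≡
               1ℤ - H (+ b * + L - + a)
    diagonal = begin
      ∑ (upTo a) (λ y → 𝟏ᴰ x y * K a b (g a b (cell x z) - g a b (cell x y)))
        -- Only the column of the fixed cell becomes `x + 0`, which makes the diagonal the east sum
        -- at distance 0.
        ≡⟨ cong (λ x′ → ∑ (upTo a) (λ y → 𝟏ᴰ x y * K a b (g a b (cell x′ z) - g a b (cell x y))))
             (sym (ℕ.+-identityʳ x)) ⟩
      ∑ (upTo a) (λ y → 𝟏ᴰ x y * K a b (g a b (cell (x ℕ.+ 0) z) - g a b (cell x y)))
        ≡⟨ ∑-column-east 0 d ⟩
      M a (+ b * + L - + a * 0ℤ)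
        ≡⟨ cong (M a) (trans (cong (λ t → + b * + L - t) (ℤ.*-zeroʳ (+ a))) (ℤ.+-identityʳ (+ b * + L))) ⟩
      H (+ b * + L) - H (+ b * + L - + a)
        ≡⟨ cong (λ t → t - H (+ b * + L - + a))
             (H-nonneg (subst (0ℤ ℤ.≤_) (ℤ.pos-* b L) (ℤ.+≤+ z≤n))) ⟩
      1ℤ - H (+ b * + L - + a) ∎
    rearrange : ∀ p q r s → (p - q) + - (r - s) ≡ (p + s) - (q + r)
    rearrange = solve-∀
    next : ∀ a l s → l - a * s - a ≡ l - a * (1ℤ + s)
    next = solve-∀
    previous : ∀ a l s → a * (1ℤ + s) - l - a ≡ a * s - l
    previous = solve-∀
    off-diagonal : ∀ s →
      ∑ (upTo a) (λ y → 𝟏ᴰ x y * K a b (g a b (cell (x ℕ.+ suc s) z) - g a b (cell x y))) +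
      ∑ (upTo a) (λ y → 𝟏ᴰ x y * K a b (g a b (cell x y) - g a b (cell (x ℕ.+ suc s) z))) ≡
      F s - F (suc s)
    off-diagonal s = begin
      _ ≡⟨ cong₂ _+_ (∑-column-east (suc s) d) (∑-column-west s d) ⟩
      M a u + - M a v
        ≡⟨ rearrange (H u) (H (u - + a)) (H v) (H (v - + a)) ⟩
      (H u + H (v - + a)) - (H (u - + a) + H v)
        ≡⟨ cong₂ (λ p q → (H u + H p) - (H q + H v))
             (previous (+ a) (+ b * + suc L) (+ s)) (next (+ a) (+ b * + L) (+ suc s)) ⟩
      F s - F (suc s) ∎
      where
      u = + b * + L - + a * + suc s
      v = + a * + suc s - + b * + suc L

  -- Regrouping `Q` by pairs of columns

  columnPair : ℕ → ℕ → ℤ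
  columnPair x x′ = ∑ (upTo a) λ y → ∑ (upTo a) λ z →
    K a b (g a b (cell x′ z) - g a b (cell x y)) * 𝟏ᴰ x y * 𝟏ᴰ x′ z

  -- Both orders of a pair of columns are brought to an outer sum over `x′`, the eastern column in
  -- use, and an inner sum over column `x`, the one that telescopes. The summations must be
  -- exchanged here; in `columnPairˡ` they already stand in that order.
  columnPairʳ : ∀ x x′ → columnPair x x′ ≡ ∑ (upTo a) λ z → 𝟏ᴰ x′ z *
    ∑ (upTo a) λ y → 𝟏ᴰ x y * K a b (g a b (cell x′ z) - g a b (cell x y))
  columnPairʳ x x′ = trans
    (∑-comm (upTo a) (upTo a) (λ y z → κ y z * 𝟏ᴰ x y * 𝟏ᴰ x′ z))
    (∑-cong (upTo a) λ z → trans
      (∑-cong (upTo a) (λ y → reorder (κ y z) (𝟏ᴰ x y) (𝟏ᴰ x′ z)))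
      (∑-distribˡ-* (upTo a) (𝟏ᴰ x′ z) (λ y → 𝟏ᴰ x y * κ y z)))
    where
    κ : ℕ → ℕ → ℤ
    κ y z = K a b (g a b (cell x′ z) - g a b (cell x y))
    reorder : ∀ k u v → k * u * v ≡ v * (u * k)
    reorder = solve-∀

  columnPairˡ : ∀ x x′ → columnPair x′ x ≡ ∑ (upTo a) λ z → 𝟏ᴰ x′ z *
    ∑ (upTo a) λ y → 𝟏ᴰ x y * K a b (g a b (cell x y) - g a b (cell x′ z))
  columnPairˡ x x′ = ∑-cong (upTo a) λ z → trans
    (∑-cong (upTo a) (λ y → reorder (κ y z) (𝟏ᴰ x′ z) (𝟏ᴰ x y)))
    (∑-distribˡ-* (upTo a) (𝟏ᴰ x′ z) (λ y → 𝟏ᴰ x y * κ y z))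
    where
    κ : ℕ → ℕ → ℤ
    κ y z = K a b (g a b (cell x y) - g a b (cell x′ z))
    reorder : ∀ k u v → k * u * v ≡ u * (v * k)
    reorder = solve-∀

  -- Exchanging the sums over `s` and `z` gathers, for each row, its part east of column `x`, the
  -- shape evaluated by `cell-contribution`.
  columnPair-sum : ∀ x →
    columnPair x x + ∑ (upTo (b ℕ.∸ suc x)) (λ s → columnPair x (x ℕ.+ suc s) + columnPair (x ℕ.+ suc s) x) ≡
    ∑ (upTo a) (λ z → 𝟏ᴰ x z * 𝟏 (balanced? a b D? (cell x z)))
  columnPair-sum x = begin
    columnPair x x + ∑ ss (λ s → columnPair x (x ℕ.+ suc s) + columnPair (x ℕ.+ suc s) x)
      ≡⟨ cong₂ _+_ (columnPairʳ x x) (∑-cong ss λ s →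
           trans (cong₂ _+_ (columnPairʳ x (x ℕ.+ suc s)) (columnPairˡ x (x ℕ.+ suc s)))
           (trans (sym (∑-distrib-+ zs (λ z → 𝟏ᴰ (x ℕ.+ suc s) z * east-sum s z) (λ z → 𝟏ᴰ (x ℕ.+ suc s) z * west-sum s z)))
           (∑-cong zs λ z → sym (ℤ.*-distribˡ-+ (𝟏ᴰ (x ℕ.+ suc s) z) (east-sum s z) (west-sum s z))))) ⟩
    ∑ zs diagonal + ∑ ss (λ s → ∑ zs (λ z → off-diagonal z s))
      ≡⟨ cong (_+_ (∑ zs diagonal)) (∑-comm ss zs (λ s z → off-diagonal z s)) ⟩
    ∑ zs diagonal + ∑ zs (λ z → ∑ ss (off-diagonal z))
      ≡⟨ sym (∑-distrib-+ zs diagonal (λ z → ∑ ss (off-diagonal z))) ⟩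
    ∑ zs (λ z → diagonal z + ∑ ss (off-diagonal z))
      ≡⟨ ∑-cong zs (cell-contribution x) ⟩
    ∑ zs (λ z → 𝟏ᴰ x z * 𝟏 (balanced? a b D? (cell x z))) ∎
    where
    open ≡-Reasoning
    ss = upTo (b ℕ.∸ suc x)
    zs = upTo a
    diagonal : ℕ → ℤ
    diagonal z = 𝟏ᴰ x z * ∑ zs λ y → 𝟏ᴰ x y * K a b (g a b (cell x z) - g a b (cell x y))
    east-sum west-sum off-diagonal : ℕ → ℕ → ℤ
    east-sum s z = ∑ zs λ y → 𝟏ᴰ x y * K a b (g a b (cell (x ℕ.+ suc s) z) - g a b (cell x y))
    west-sum s z = ∑ zs λ y → 𝟏ᴰ x y * K a b (g a b (cell x y) - g a b (cell (x ℕ.+ suc s) z))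
    off-diagonal z s = 𝟏ᴰ (x ℕ.+ suc s) z * (east-sum s z + west-sum s z)

  -- `D` lies in `G`, so each summand vanishes as soon as one index leaves `G`, and both sums extend
  -- to the rectangle.
  Q≡∑-columnPair : Q a b (indicator D?) ≡ ∑ (upTo b) (λ x → ∑ (upTo b) (columnPair x))
  Q≡∑-columnPair = begin
    ∑ (cellsG a b) (λ i → ∑ (cellsG a b) (term i))
      ≡⟨ ∑-cellsG a b (λ i i∉G → trans
           (∑-cong (cellsG a b) λ j → vanishˡ (κ i j) (𝟏 (D? j)) (𝟏-false (D? i) (i∉G ∘ D⊆G)))
           (∑-zero (cellsG a b))) ⟩
    ∑ xs (λ x → ∑ ys (λ y → ∑ (cellsG a b) (term (cell x y))))
      ≡⟨ ∑-cong xs (λ x → ∑-cong ys λ y → ∑-cellsG a b λ j j∉G →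
           vanishʳ (κ (cell x y) j * 𝟏ᴰ x y) (𝟏-false (D? j) (j∉G ∘ D⊆G))) ⟩
    ∑ xs (λ x → ∑ ys (λ y → ∑ xs (λ x′ → ∑ ys (λ z → term (cell x y) (cell x′ z)))))
      ≡⟨ ∑-cong xs (λ x → ∑-comm ys xs (λ y x′ → ∑ ys (λ z → term (cell x y) (cell x′ z)))) ⟩
    ∑ xs (λ x → ∑ xs (columnPair x)) ∎
    where
    open ≡-Reasoning
    xs = upTo b
    ys = upTo a
    κ term : Cell → Cell → ℤ
    κ i j = K a b (g a b j - g a b i)
    term i j = κ i j * 𝟏 (D? i) * 𝟏 (D? j)
    vanishʳ : ∀ k {v} → v ≡ 0ℤ → k * v ≡ 0ℤ
    vanishʳ k refl = ℤ.*-zeroʳ k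
    vanishˡ : ∀ k {u} v → u ≡ 0ℤ → k * u * v ≡ 0ℤ
    vanishˡ k v refl = trans (cong (_* v) (ℤ.*-zeroʳ k)) (ℤ.*-zeroˡ v)

  dinv≡∑ : + dinv a b D? ≡
    ∑ (upTo b) (λ x → ∑ (upTo a) (λ z → 𝟏ᴰ x z * 𝟏 (balanced? a b D? (cell x z))))
  dinv≡∑ = begin
    + dinv a b D?
      ≡⟨ length-filter (λ c → D? c ×-dec balanced? a b D? c) (cellsG a b) ⟩
    ∑ (cellsG a b) (λ c → 𝟏 (D? c ×-dec balanced? a b D? c))
      ≡⟨ ∑-cellsG a b (λ c c∉G → 𝟏-false (D? c ×-dec balanced? a b D? c) (c∉G ∘ D⊆G ∘ proj₁)) ⟩
    ∑ (upTo b) (λ x → ∑ (upTo a) (λ z → 𝟏 (D? (cell x z) ×-dec balanced? a b D? (cell x z))))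
      ≡⟨ ∑-cong (upTo b) (λ x → ∑-cong (upTo a) λ z → 𝟏-× (D? (cell x z)) (balanced? a b D? (cell x z))) ⟩
    ∑ (upTo b) (λ x → ∑ (upTo a) (λ z → 𝟏ᴰ x z * 𝟏 (balanced? a b D? (cell x z)))) ∎
    where open ≡-Reasoning

  Q≡dinv : Q a b (indicator D?) ≡ + dinv a b D?
  Q≡dinv = begin
    Q a b (indicator D?)
      ≡⟨ Q≡∑-columnPair ⟩
    ∑ (upTo b) (λ x → ∑ (upTo b) (columnPair x))
      ≡⟨ ∑∑-triangle b columnPair ⟩
    ∑ (upTo b) (λ x → columnPair x x +
      ∑ (upTo (b ℕ.∸ suc x)) (λ s → columnPair x (x ℕ.+ suc s) + columnPair (x ℕ.+ suc s) x))
      ≡⟨ ∑-cong (upTo b) columnPair-sum ⟩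
    ∑ (upTo b) (λ x → ∑ (upTo a) (λ z → 𝟏ᴰ x z * 𝟏 (balanced? a b D? (cell x z))))
      ≡⟨ sym dinv≡∑ ⟩
    + dinv a b D? ∎
    where open ≡-Reasoning

  -- Positivity

  corner-balanced : ∀ {c} → arm a b D? c ≡ 0 → leg a b D? c ≡ 0 → Balanced a b D? c
  corner-balanced {c} arm≡0 leg≡0 = Equivalence.from (balanced⇔ a b D? c)
    (subst₂ (λ A L → b ℕ.* L < a ℕ.* suc A × a ℕ.* A < b ℕ.* suc L) (sym arm≡0) (sym leg≡0)
      ( subst₂ _<_ (sym (ℕ.*-zeroʳ b)) (sym (ℕ.*-identityʳ a)) 0<a
      , subst₂ _<_ (sym (ℕ.*-zeroʳ a)) (sym (ℕ.*-identityʳ b)) (ℕ.>-nonZero⁻¹ b)))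

  -- Go east from `c` to the end of the row, then north to the end of that column. The leg is 0
  -- there by maximality; a positive arm there would, by downward closure, prolong the row of `c`.
  ∃-corner : ∀ {c} → D c → ∃ λ c′ → D c′ × arm a b D? c′ ≡ 0 × leg a b D? c′ ≡ 0
  ∃-corner {c@(x , y)} d = c₂ , d₂ ,
    ℕ.n≤0⇒n≡0 (ℕ.+-cancelˡ-≤ A _ _ (ℕ.≤-trans (upper (arm-max d) {A ℕ.+ A₂} arm-end) (ℕ.≤-reflexive (sym (ℕ.+-identityʳ A))))) ,
    ℕ.n≤0⇒n≡0 (ℕ.+-cancelˡ-≤ L _ _ (ℕ.≤-trans (upper (leg-max d₁) {L ℕ.+ L₂} leg-end) (ℕ.≤-reflexive (sym (ℕ.+-identityʳ L)))))
    where
    arm-max : ∀ {c} → D c → IsMax (λ k → D (east c k)) (arm a b D? c)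
    arm-max = arm-isMax {a = a} {b = b} D? D⊆G
    leg-max : ∀ {c} → D c → IsMax (λ k → D (north c k)) (leg a b D? c)
    leg-max = leg-isMax {a = a} {b = b} D? D⊆G
    A = arm a b D? c
    c₁ = east c A
    d₁ : D c₁
    d₁ = attained (arm-max d)
    L = leg a b D? c₁
    c₂ = north c₁ L
    d₂ : D c₂
    d₂ = attained (leg-max d₁)
    A₂ = arm a b D? c₂
    L₂ = leg a b D? c₂
    leg-end : D (north c₁ (L ℕ.+ L₂))
    leg-end = subst (λ t → D (x + + A , t)) (ℤ.+-assoc y (+ L) (+ L₂)) (attained (leg-max d₂))
    -- This cell lies `L` rows below the end of the arm of `c₂`, which is in `D`.
    arm-end : D (east c (A ℕ.+ A₂))
    arm-end = D-down (attained (arm-max d₂))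
      (ℤ.≤-trans (proj₁ (D⊆G d)) (ℤ.i≤i+j x (+ (A ℕ.+ A₂)))) (proj₁ (proj₂ (D⊆G d)))
      (ℤ.≤-reflexive (sym (ℤ.+-assoc x (+ A) (+ A₂)))) (ℤ.i≤i+j y (+ L))

  -- A negated emptiness yields no cell outright, so the argument is by contradiction: if `dinv`
  -- were 0, any cell of `D` would lead to a corner, and that corner is counted.
  dinv-positive : ¬ Empty D → 0 < dinv a b D?
  dinv-positive D≢∅ = ℕ.n≢0⇒n>0 λ dinv≡0 → D≢∅ λ c d →
    let c′ , d′ , arm≡0 , leg≡0 = ∃-corner d in
    contradiction dinv≡0 (length≢0 (∈-filter⁺ (λ c → D? c ×-dec balanced? a b D? c)
      (∈-cellsG⁺ {a} {b} (D⊆G d′)) (d′ , corner-balanced arm≡0 leg≡0)))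
    where
    length≢0 : ∀ {c : Cell} {xs} → c ∈ xs → length xs ≢ 0
    length≢0 {xs = _ ∷ _} _ ()

theorem1p1 : ∀ {ℓ : Level} (a b : ℕ) .{{_ : NonZero b}} →
    1 < a → a < b → Coprime a b →
    (D : Pred Cell ℓ) (D? : Decidable D) → IsSubdiagram a b D →
    (Q a b (indicator D?) ≡ + dinv a b D?) ×
    (¬ Empty D → 0ℤ ℤ.< Q a b (indicator D?))
theorem1p1 a b 1<a _ _ D D? D-sub =
  Q≡dinv a b 0<a D? D-sub ,
  λ D≢∅ → subst (0ℤ ℤ.<_) (sym (Q≡dinv a b 0<a D? D-sub)) (ℤ.+<+ (dinv-positive a b 0<a D? D-sub D≢∅))
  where
  0<a = ℕ.<-trans (s≤s z≤n) 1<a
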